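{- For a shape $\lambda$ and a pattern $\sigma$, let $\lambda_{sym}(\{\sigma\})$ be the number of symmetric full placements on $\lambda$ which avoid $\sigma$. Let $\alpha$ and $\beta$ be involutions in $\mathcal{S}_j$. If for every self-conjugate shape $\lambda$ we have $\lambda_{sym}(\{\alpha\})=\lambda_{sym}(\{\beta\})$, then the prefixes $\alpha$ and $\beta$ may be exchanged.
   Context: A shape is a Ferrers shape $\lambda=(\lambda_1\ge\lambda_2\ge\cdots\ge\lambda_k>0)$, coordinatized from the bottom left corner: box $(x,y)$ (column $x$ from the left, row $y$ from the bottom) belongs to $\lambda$ iff $1\le y\le k$ and $1\le x\le\lambda_y$. It is self-conjugate if $(x,y)\in\lambda$ iff $(y,x)\in\lambda$. A placement on $\lambda$ is an assignment of dots to some boxes of $\lambda$ such that no row or column contains more than one dot; it is full if each row and each column of $\lambda$ contains exactly one dot. A placement on a self-conjugate shape is symmetric if it has a dot in $(x,y)$ iff it has a dot in $(y,x)$. The pattern of a sequence of $m$ distinct numbers is its order-preserving relabelling by $1,\dots,m$. A placement on $\lambda$ contains $\sigma\in\mathcal{S}_m$ if there are $m$ dots $(x_1,y_1),\dots,(x_m,y_m)$ in the placement with $x_1<\cdots<x_m$, with the pattern of $y_1\ldots y_m$ equal to $\sigma$, and all lying in a rectangular subshape of $\lambda$ (i.e. the box $(\max_i x_i,\max_i y_i)$ lies in $\lambda$). Otherwise it avoids $\sigma$. A permutation $\pi\in\mathcal{S}_n$ avoids $\sigma\in\mathcal{S}_m$ if no subsequence of $\pi_1\ldots\pi_n$ has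 pattern $\sigma$. $\mathcal{I}_n(\sigma)$ is the number of involutions in $\mathcal{S}_n$ (permutations whose square is the identity) which avoid $\sigma$. For $\alpha,\beta\in\mathcal{S}_j$, the prefixes $\alpha$ and $\beta$ may be exchanged if for every $k\ge j$, every ordering $\tau=\tau_{j+1}\ldots\tau_k$ of $\{j+1,\dots,k\}$, and every $n$, $\mathcal{I}_n(\alpha_1\ldots\alpha_j\tau_{j+1}\ldots\tau_k)=\mathcal{I}_n(\beta_1\ldots\beta_j\tau_{j+1}\ldots\tau_k)$. -}

module Defs where

open import Algebra.Definitions using (Involutive)
open import Data.Bool.Base using (Bool; true; false)
open import Data.Fin.Base using (Fin; zero; toℕ; _<_)
open import Data.Fin.Permutation using (Permutation′; _⟨$⟩ʳ_)
open import Data.Fin.Properties using (+↔⊎; _≟_; _<?_; all?; any?)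
open import Data.Fin.Subset using (Subset; _∈_)
open import Data.Fin.Subset.Properties using (_∈?_)
open import Data.List.Base using (List; []; _∷_; [_]; length; filter; allFin; cartesianProductWith)
import Data.List.Membership.Propositional as List
open import Data.List.Membership.Propositional.Properties using (∈-cartesianProductWith⁺; ∈-allFin)
import Data.List.Relation.Unary.All as All
import Data.List.Relation.Unary.AllPairs as AllPairs
open import Data.List.Relation.Unary.Any as Any using (here; there)
open import Data.List.Relation.Unary.Unique.Propositional using (Unique)
open import Data.List.Relation.Unary.Unique.Propositional.Properties
  using (cartesianProductWith⁺; allFin⁺)
open import Data.Nat.Base as ℕ using (ℕ; zero; suc)
import Data.Nat.Properties as ℕ
open import Data.Product.Base using (∃; _×_; _,_)
open import Data.Product using (∃!)
open import Data.Sum.Function.Propositional using (_⊎-↔_)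
open import Data.Vec.Base using (Vec; []; _∷_; lookup)
open import Data.Vec.Properties using (∷-injective)
open import Function.Bundles using (_⇔_; mk⇔; Equivalence)
open import Function.Construct.Composition using (_↔-∘_)
open import Function.Construct.Symmetry using (↔-sym)
open import Function.Definitions using (Injective)
open import Level using (Level)
open import Relation.Binary.PropositionalEquality using (_≡_; refl)
open import Relation.Nullary using (¬_; Dec)
open import Relation.Nullary.Decidable using (map′; ¬?; _×-dec_; _→-dec_)
open import Relation.Unary using (Pred; Decidable)

private
  variable
    a p q : Level
    A : Set a
    j k l m n : ℕ

------------------------------------------------------------------------
-- Counting

count : {P : Pred A p} → Decidable P → List A → ℕ
count P? xs = length (filter P? xs)

vecs : List A → (n : ℕ) → List (Vec A n)
vecs xs zero    = [ [] ]
vecs xs (suc n) = cartesianProductWith _∷_ xs (vecs xs n)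

-- If xs lists every element of A exactly once, so does vecs xs n for
-- Vec A n; hence count over it is a genuine cardinality.

vecs-complete : {xs : List A} → (∀ x → x List.∈ xs) →
                (v : Vec A n) → v List.∈ vecs xs n
vecs-complete c []      = here refl
vecs-complete c (x ∷ v) = ∈-cartesianProductWith⁺ _∷_ (c x) (vecs-complete c v)

vecs-unique : {xs : List A} → Unique xs → ∀ n → Unique (vecs xs n)
vecs-unique u zero    = All.[] AllPairs.∷ AllPairs.[]
vecs-unique u (suc n) = cartesianProductWith⁺ _∷_ ∷-injective u (vecs-unique u n)

words : (m n : ℕ) → List (Vec (Fin n) m)
words m n = vecs (allFin n) m

∃word? : {P : Pred (Vec (Fin n) m) p} → Decidable P → Dec (∃ P)
∃word? {n = n} {m = m} P? =
  map′ (λ e → let w , _ , Pw = List.find e in w , Pw)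
       (λ (w , Pw) → List.lose (vecs-complete ∈-allFin w) Pw)
       (Any.any? P? (words m n))

_⇔-dec_ : {P : Set p} {Q : Set q} → Dec P → Dec Q → Dec (P ⇔ Q)
P? ⇔-dec Q? =
  map′ (λ (f , g) → mk⇔ f g) (λ e → Equivalence.to e , Equivalence.from e)
       ((P? →-dec Q?) ×-dec (Q? →-dec P?))

∃!? : {P : Pred (Fin n) p} → Decidable P → Dec (∃! _≡_ P)
∃!? P? =
  map′ (λ (x , Px , u) → x , Px , λ {y} → u y)
       (λ (x , Px , u) → x , Px , λ y → u {y})
       (any? λ x → P? x ×-dec all? λ y → P? y →-dec (x ≟ y))

------------------------------------------------------------------------
-- Patterns

Increasing : Vec (Fin n) m → Set
Increasing is = ∀ a b → a < b → lookup is a < lookup is b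

increasing? : Decidable (Increasing {n} {m})
increasing? is = all? λ a → all? λ b → (a <? b) →-dec (lookup is a <? lookup is b)

-- σ is the order-preserving relabelling of the sequence y.
HasPattern : (Fin m → Fin n) → Permutation′ m → Set
HasPattern y σ = ∀ a b → y a < y b ⇔ σ ⟨$⟩ʳ a < σ ⟨$⟩ʳ b

hasPattern? : (y : Fin m → Fin n) (σ : Permutation′ m) → Dec (HasPattern y σ)
hasPattern? y σ = all? λ a → all? λ b → (y a <? y b) ⇔-dec (σ ⟨$⟩ʳ a <? σ ⟨$⟩ʳ b)

------------------------------------------------------------------------
-- Involutions avoiding a pattern

-- For counting, a permutation of Fin n is given by its one-line notation
-- w, a word of length n without repeated letters. (The type Permutation′ n
-- is unsuitable here: its _≡_ is not extensional.)

IsPermutation : Pred (Vec (Fin n) n) _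
IsPermutation w = Injective _≡_ _≡_ (lookup w)

isPermutation? : Decidable (IsPermutation {n})
isPermutation? w =
  map′ (λ f {i} {j} → f i j) (λ f i j → f {i} {j})
       (all? λ i → all? λ j → (lookup w i ≟ lookup w j) →-dec (i ≟ j))

ContainsPerm : Permutation′ m → Pred (Vec (Fin n) n) _
ContainsPerm {m} {n} σ w =
  ∃ λ (is : Vec (Fin n) m) →
    Increasing is × HasPattern (λ a → lookup w (lookup is a)) σ

containsPerm? : (σ : Permutation′ m) → Decidable (ContainsPerm {m} {n} σ)
containsPerm? σ w = ∃word? λ is → increasing? is ×-dec hasPattern? _ σ

InvolutionAvoiding : Permutation′ m → Pred (Vec (Fin n) n) _
InvolutionAvoiding σ w =
  IsPermutation w × Involutive _≡_ (lookup w) × ¬ ContainsPerm σ w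

involutionAvoiding? : (σ : Permutation′ m) → Decidable (InvolutionAvoiding {m} {n} σ)
involutionAvoiding? σ w =
  isPermutation? w
    ×-dec (all? λ i → lookup w (lookup w i) ≟ i)
    ×-dec ¬? (containsPerm? σ w)

𝓘 : (n : ℕ) → Permutation′ m → ℕ
𝓘 n σ = count (involutionAvoiding? σ) (words n n)

-- The one-line notation α₁ … αⱼ τⱼ₊₁ … τₖ with k = j + l, where the ordering
-- τⱼ₊₁ … τₖ of {j+1, …, k} is τ : Permutation′ l with its values shifted
-- up by j.
_⊕_ : Permutation′ j → Permutation′ l → Permutation′ (j ℕ.+ l)
α ⊕ τ = ↔-sym +↔⊎ ↔-∘ ((α ⊎-↔ τ) ↔-∘ +↔⊎)

PrefixesMayBeExchanged : Permutation′ j → Permutation′ j → Set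
PrefixesMayBeExchanged α β =
  ∀ l (τ : Permutation′ l) n → 𝓘 n (α ⊕ τ) ≡ 𝓘 n (β ⊕ τ)

------------------------------------------------------------------------
-- Shapes

-- Coordinates are 0-based: row y (from the bottom) has length row y, and
-- box (x , y) is in column x and row y.
record Shape : Set where
  field
    height   : ℕ
    row      : Fin height → ℕ
    antitone : ∀ y y′ → y < y′ → row y′ ℕ.≤ row y
    positive : ∀ y → 0 ℕ.< row y

  width : ℕ
  width = first row
    where
    first : (Fin k → ℕ) → ℕ
    first {zero}  r = 0
    first {suc _} r = r zero

  Column Row : Set
  Column = Fin width
  Row    = Fin height

  -- Every box of the shape has its coordinates in Column and Row.
  Box : Column → Row → Set
  Box x y = toℕ x ℕ.< row y

  box? : ∀ x y → Dec (Box x y)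
  box? x y = toℕ x ℕ.<? row y

open Shape

infix 4 _∈ˢ_
_∈ˢ_ : ℕ × ℕ → Shape → Set
(x , y) ∈ˢ Λ = ∃ λ (r : Row Λ) → toℕ r ≡ y × x ℕ.< row Λ r

SelfConjugate : Shape → Set
SelfConjugate Λ = ∀ x y → (x , y) ∈ˢ Λ ⇔ (y , x) ∈ˢ Λ

------------------------------------------------------------------------
-- Placements

-- Row by row, the set of columns that hold a dot.
Dots : Shape → Set
Dots Λ = Vec (Subset (width Λ)) (height Λ)

bools : List Bool
bools = false ∷ true ∷ []

allDots : (Λ : Shape) → List (Dots Λ)
allDots Λ = vecs (vecs bools (width Λ)) (height Λ)

allDots-complete : (Λ : Shape) (D : Dots Λ) → D List.∈ allDots Λ
allDots-complete Λ = vecs-complete (vecs-complete λ where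
  false → here refl
  true  → there (here refl))

allDots-unique : (Λ : Shape) → Unique (allDots Λ)
allDots-unique Λ = vecs-unique (vecs-unique
  (((λ ()) All.∷ All.[]) AllPairs.∷ All.[] AllPairs.∷ AllPairs.[]) _) _

module _ (Λ : Shape) where

  Dot : Dots Λ → Column Λ → Row Λ → Set
  Dot D x y = x ∈ lookup D y

  dot? : ∀ D x y → Dec (Dot D x y)
  dot? D x y = x ∈? lookup D y

  record IsPlacement (D : Dots Λ) : Set where
    constructor isPlacement
    field
      inShape     : ∀ x y → Dot D x y → Box Λ x y
      rowAtMost1  : ∀ y x x′ → Dot D x y → Dot D x′ y → x ≡ x′
      colAtMost1  : ∀ x y y′ → Dot D x y → Dot D x y′ → y ≡ y′

  isPlacement? : Decidable IsPlacement
  isPlacement? D =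
    map′ (λ (s , r , c) → isPlacement s r c)
         (λ P → let open IsPlacement P in inShape , rowAtMost1 , colAtMost1)
         ((all? λ x → all? λ y → dot? D x y →-dec box? Λ x y)
           ×-dec (all? λ y → all? λ x → all? λ x′ →
                    dot? D x y →-dec dot? D x′ y →-dec x ≟ x′)
           ×-dec (all? λ x → all? λ y → all? λ y′ →
                    dot? D x y →-dec dot? D x y′ →-dec y ≟ y′))

  IsFull : Pred (Dots Λ) _
  IsFull D = (∀ y → ∃! _≡_ λ x → Dot D x y) × (∀ x → ∃! _≡_ λ y → Dot D x y)

  isFull? : Decidable IsFull
  isFull? D = (all? λ y → ∃!? λ x → dot? D x y) ×-dec (all? λ x → ∃!? λ y → dot? D x y)

  -- (x′ , y′) is the transposed box (y , x). A self-conjugate shape has equal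
  -- width and height, so there every (x , y) has such an (x′ , y′); the notion
  -- is meant for self-conjugate shapes only.
  IsSymmetric : Pred (Dots Λ) _
  IsSymmetric D = ∀ x y x′ y′ → toℕ x′ ≡ toℕ y → toℕ y′ ≡ toℕ x →
                  Dot D x y ⇔ Dot D x′ y′

  isSymmetric? : Decidable IsSymmetric
  isSymmetric? D =
    all? λ x → all? λ y → all? λ x′ → all? λ y′ →
      (toℕ x′ ℕ.≟ toℕ y) →-dec (toℕ y′ ℕ.≟ toℕ x) →-dec
      (dot? D x y ⇔-dec dot? D x′ y′)

  -- The rectangle formed by the first c columns and the first r rows.
  RectangularSubshape : Fin (suc (width Λ)) → Fin (suc (height Λ)) → Set
  RectangularSubshape c r = ∀ x y → toℕ x ℕ.< toℕ c → toℕ y ℕ.< toℕ r → Box Λ x y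

  InRectangle : Vec (Column Λ) m → Vec (Row Λ) m → Set
  InRectangle xs ys =
    ∃ λ c → ∃ λ r → RectangularSubshape c r ×
      (∀ a → toℕ (lookup xs a) ℕ.< toℕ c × toℕ (lookup ys a) ℕ.< toℕ r)

  inRectangle? : (xs : Vec (Column Λ) m) (ys : Vec (Row Λ) m) → Dec (InRectangle xs ys)
  inRectangle? xs ys =
    any? λ c → any? λ r →
      (all? λ x → all? λ y →
        (toℕ x ℕ.<? toℕ c) →-dec (toℕ y ℕ.<? toℕ r) →-dec box? Λ x y)
      ×-dec (all? λ a →
        (toℕ (lookup xs a) ℕ.<? toℕ c) ×-dec (toℕ (lookup ys a) ℕ.<? toℕ r))

  Contains : Permutation′ m → Pred (Dots Λ) _
  Contains {m} σ D =
    ∃ λ (xs : Vec (Column Λ) m) → ∃ λ (ys : Vec (Row Λ) m) →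
      (∀ a → Dot D (lookup xs a) (lookup ys a)) ×
      Increasing xs × HasPattern (lookup ys) σ × InRectangle xs ys

  contains? : (σ : Permutation′ m) → Decidable (Contains σ)
  contains? σ D =
    ∃word? λ xs → ∃word? λ ys →
      (all? λ a → dot? D (lookup xs a) (lookup ys a))
        ×-dec increasing? xs ×-dec hasPattern? (lookup ys) σ ×-dec inRectangle? xs ys

  SymFullAvoiding : Permutation′ m → Pred (Dots Λ) _
  SymFullAvoiding σ D =
    IsPlacement D × IsFull D × IsSymmetric D × ¬ Contains σ D

  symFullAvoiding? : (σ : Permutation′ m) → Decidable (SymFullAvoiding σ)
  symFullAvoiding? σ D =
    isPlacement? D ×-dec isFull? D ×-dec isSymmetric? D ×-dec ¬? (contains? σ D)

-- λ_sym({σ})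
_sym⟨_⟩ : Shape → Permutation′ m → ℕ
Λ sym⟨ σ ⟩ = count (symFullAvoiding? Λ σ) (allDots Λ)

{-# OPTIONS --safe #-}
module Submission where

-- An involution containing α ⊕ τ, with α an involution, also contains its
-- inverse α ⊕ τ⁻¹. Shade a box when a copy of τ or of τ⁻¹ lies strictly to its
-- north-east. For α nonempty, the involution w contains α ⊕ τ iff its dots
-- contain a copy of α inside a shaded rectangle. The shaded boxes form a
-- self-conjugate shape which is determined by the unshaded dots alone. Hence
-- the involutions with prescribed unshaded dots correspond to the symmetric
-- full placements on this shape with its empty rows and columns deleted, and
-- those avoiding α ⊕ τ to the placements avoiding α. Summing over the possible
-- sets of unshaded dots gives the theorem.

open import Defs
open import Algebra.Definitions using (Involutive)
open import Data.Bool.Base using (true; if_then_else_)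
open import Data.Fin.Base
  using (Fin; zero; suc; toℕ; fromℕ; fromℕ<; cast; _<_; _≤_; _>_; _↑ˡ_; _↑ʳ_; splitAt; join)
open import Data.Fin.Induction using (>-wellFounded)
open import Data.Fin.Permutation using (Permutation′; _⟨$⟩ʳ_)
open import Data.Fin.Properties
  using (_≟_; _<?_; all?; any?; injective⇒≤; <-cmp; <-asym; <-irrefl; ≤fromℕ; toℕ-↑ˡ;
    toℕ-↑ʳ; toℕ<n; toℕ-injective; toℕ-cast; toℕ-fromℕ<; splitAt-↑ˡ; splitAt-↑ʳ;
    join-splitAt)
open import Data.Fin.Subset using (Subset; _∈_)
open import Data.Fin.Subset.Properties using (⊆-antisym)
open import Data.List.Base as List using (List; []; _∷_; length; filter)
import Data.List.Membership.Propositional as List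
open import Data.List.Membership.Propositional.Properties as List
  using (∈-filter⁺; ∈-filter⁻; ∈-allFin; ∈-lookup)
open import Data.List.Properties using (filter-≐; filter-none)
open import Data.List.Relation.Unary.All as All using (All)
open import Data.List.Relation.Unary.All.Properties using (all-filter)
import Data.List.Relation.Unary.AllPairs as AllPairs
open import Data.List.Relation.Unary.Any as Any using (Any; here; there)
open import Data.List.Relation.Unary.Any.Properties using (lookup-index)
open import Data.List.Relation.Unary.Unique.Propositional using (Unique)
import Data.List.Relation.Unary.Unique.Propositional.Properties as Unique
open import Data.Maybe.Base using (Maybe; just; nothing)
import Data.Maybe.Properties as Maybe
open import Data.Nat.Base as ℕ using (ℕ; zero; suc; z≤n; s≤s)
import Data.Nat.Properties as ℕ
open import Data.Product.Base using (∃; _×_; _,_; proj₁; proj₂)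
open import Data.Sum.Base as Sum using (_⊎_; inj₁; inj₂; [_,_]′)
open import Data.Vec.Base using (Vec; lookup; tabulate; _++_)
open import Data.Vec.Properties
  using (lookup∘tabulate; tabulate∘lookup; tabulate-cong; lookup-++ˡ; lookup-++ʳ;
    lookup⇒[]=; []=⇒lookup)
open import Function.Base using (_∘_; const; flip)
open import Function.Bundles using (_⇔_; mk⇔; Equivalence)
open import Function.Construct.Composition using (_⇔-∘_)
open import Function.Construct.Symmetry using (⇔-sym)
open import Function.Definitions using (Injective)
open import Induction.WellFounded using (Acc; acc)
open import Level using (Level)
open import Relation.Binary.Core using (Rel)
open import Relation.Binary.Definitions as Rel using (tri<; tri≈; tri>)
open import Relation.Binary.PropositionalEquality
  using (_≡_; refl; sym; trans; cong; cong₂; subst; subst₂)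
open import Relation.Nullary using (¬_; Dec; yes; no; does; contradiction)
open import Relation.Nullary.Decidable using (dec-true; dec-false; map′; _×-dec_; _⊎-dec_)
open import Relation.Unary using (Pred; Decidable; _∩_; _∪_; ∁; _⊆_; Empty)
open import Relation.Unary.Properties using (_∩?_; ∁?)

private
  variable
    a b p q r t : Level
    A : Set a
    B : Set b
    j l m n s : ℕ

-- Counting

module _ {P : Pred A p} {Q : Pred A q} (P? : Decidable P) (Q? : Decidable Q) where

  count-≐ : P ⊆ Q → Q ⊆ P → ∀ xs → count P? xs ≡ count Q? xs
  count-≐ P⊆Q Q⊆P xs = cong length (filter-≐ P? Q? (P⊆Q , Q⊆P) xs)

  count-split : ∀ xs → count P? xs ≡ count (P? ∩? Q?) xs ℕ.+ count (P? ∩? ∁? Q?) xs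
  count-split []       = refl
  count-split (x ∷ xs) with P? x | Q? x
  ... | yes _ | yes _ = cong suc (count-split xs)
  ... | yes _ | no  _ = trans (cong suc (count-split xs)) (sym (ℕ.+-suc _ _))
  ... | no  _ | _     = count-split xs

count-∅ : {P : Pred A p} (P? : Decidable P) → Empty P → ∀ xs → count P? xs ≡ 0
count-∅ P? ∅ xs = cong length (filter-none P? (All.universal ∅ xs))

module _ {R : Rel A r} (R? : Rel.Decidable R)
         (R-sym : Rel.Symmetric R) (R-trans : Rel.Transitive R) where

  -- Induction on `reps`: the class of the first representative is split off from both counts, and
  -- the remaining representatives cover what is left. Several entries of `reps` may represent the
  -- same class.
  count-classes : {P : Pred A p} {Q : Pred A q} (P? : Decidable P) (Q? : Decidable Q)
    (xs reps : List A) →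
    (∀ {x} → (P ∪ Q) x → Any (R x) reps) →
    (∀ {k} → k List.∈ reps → count (P? ∩? R? k) xs ≡ count (Q? ∩? R? k) xs) →
    count P? xs ≡ count Q? xs
  count-classes P? Q? xs [] cover eq =
    trans (count-∅ P? (λ _ Px → contradiction (cover (inj₁ Px)) λ ()) xs)
          (sym (count-∅ Q? (λ _ Qx → contradiction (cover (inj₂ Qx)) λ ()) xs))
  count-classes {P = P} {Q = Q} P? Q? xs (k ∷ reps) cover eq =
    trans (count-split P? (R? k) xs)
      (trans (cong₂ ℕ._+_ (eq (here refl)) rest) (sym (count-split Q? (R? k) xs)))
    where
    cover′ : ∀ {x} → ((P ∩ ∁ (R k)) ∪ (Q ∩ ∁ (R k))) x → Any (R x) reps
    cover′ h with cover (Sum.map proj₁ proj₁ h)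
    ... | here Rxk = contradiction (R-sym Rxk) ([ proj₂ , proj₂ ]′ h)
    ... | there i  = i

    eq′ : ∀ {k′} → k′ List.∈ reps →
          count ((P? ∩? ∁? (R? k)) ∩? R? k′) xs ≡ count ((Q? ∩? ∁? (R? k)) ∩? R? k′) xs
    eq′ {k′} k′∈ with R? k k′
    -- The class of `k′` is that of `k`, which has just been removed, so both counts vanish.
    ... | yes Rkk′ =
      trans (vanish P?) (sym (vanish Q?))
      where
      vanish : ∀ {t} {T : Pred A t} (T? : Decidable T) →
               count ((T? ∩? ∁? (R? k)) ∩? R? k′) xs ≡ 0
      vanish T? = count-∅ ((T? ∩? ∁? (R? k)) ∩? R? k′)
        (λ _ ((_ , ¬R) , R′) → ¬R (R-trans Rkk′ R′)) xs
    -- The classes of `k` and `k′` are disjoint, so removing one leaves the other intact.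
    ... | no ¬Rkk′ = trans (drop P?) (trans (eq (there k′∈)) (sym (drop Q?)))
      where
      drop : ∀ {t} {T : Pred A t} (T? : Decidable T) →
             count ((T? ∩? ∁? (R? k)) ∩? R? k′) xs ≡ count (T? ∩? R? k′) xs
      drop T? = count-≐ ((T? ∩? ∁? (R? k)) ∩? R? k′) (T? ∩? R? k′)
        (λ ((Tx , _) , R′) → Tx , R′)
        (λ (Tx , R′) → (Tx , λ Rkx → ¬Rkk′ (R-trans Rkx (R-sym R′))) , R′) xs

    rest : count (P? ∩? ∁? (R? k)) xs ≡ count (Q? ∩? ∁? (R? k)) xs
    rest = count-classes (P? ∩? ∁? (R? k)) (Q? ∩? ∁? (R? k)) xs reps cover′ eq′

lookup-injective : {xs : List A} → Unique xs → Injective _≡_ _≡_ (List.lookup xs)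
lookup-injective (_ AllPairs.∷ _)  {zero}  {zero}  _  = refl
lookup-injective (x∉ AllPairs.∷ _) {zero}  {suc j} eq = contradiction eq (All.lookup x∉ (∈-lookup j))
lookup-injective (x∉ AllPairs.∷ _) {suc i} {zero}  eq = contradiction (sym eq) (All.lookup x∉ (∈-lookup i))
lookup-injective (_ AllPairs.∷ u)  {suc i} {suc j} eq = cong suc (lookup-injective u eq)

module _ {P : Pred A p} {Q : Pred B q} (P? : Decidable P) (Q? : Decidable Q)
         {xs : List A} {ys : List B} (T : A → B → Set t) where

  -- The image of `x` may depend on the proof of `P x`, hence a relation `T` in place of a function.
  -- Sending a position in the filtered `xs` to the position of its image in the filtered `ys` is
  -- injective, because `T` relates no two elements of `P` to the same `y`.
  count-≤ : Unique xs → (∀ y → y List.∈ ys) →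
    (∀ {x} → P x → ∃ λ y → Q y × T x y) →
    (∀ {x x′ y} → P x → P x′ → T x y → T x′ y → x ≡ x′) →
    count P? xs ℕ.≤ count Q? ys
  count-≤ uniq complete total inj = injective⇒≤ {f = f} f-injective
    where
    Pxs = filter P? xs

    P-lookup : ∀ i → P (List.lookup Pxs i)
    P-lookup i = All.lookup (all-filter P? xs) (∈-lookup i)

    image : Fin (length Pxs) → B
    image i = proj₁ (total (P-lookup i))

    image-∈ : ∀ i → image i List.∈ filter Q? ys
    image-∈ i = ∈-filter⁺ Q? (complete _) (proj₁ (proj₂ (total (P-lookup i))))

    f : Fin (length Pxs) → Fin (count Q? ys)
    f i = Any.index (image-∈ i)

    f-injective : Injective _≡_ _≡_ f
    f-injective {i} {i′} eq = lookup-injective (Unique.filter⁺ P? uniq)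
      (inj (P-lookup i) (P-lookup i′) (proj₂ (proj₂ (total (P-lookup i))))
        (subst (T _) (sym same) (proj₂ (proj₂ (total (P-lookup i′))))))
      where
      same : image i ≡ image i′
      same = trans (lookup-index (image-∈ i))
        (trans (cong (List.lookup (filter Q? ys)) eq) (sym (lookup-index (image-∈ i′))))

module _ {P : Pred A p} {Q : Pred B q} (P? : Decidable P) (Q? : Decidable Q)
         {xs : List A} {ys : List B} (T : A → B → Set t) where

  -- `count-≤` in both directions; injectivity of `flip T` is the determinacy of `T`.
  count-≡ : Unique xs → (∀ x → x List.∈ xs) → Unique ys → (∀ y → y List.∈ ys) →
    (∀ {x} → P x → ∃ λ y → Q y × T x y) →
    (∀ {y} → Q y → ∃ λ x → P x × T x y) →
    (∀ {x x′ y} → P x → P x′ → T x y → T x′ y → x ≡ x′) →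
    (∀ {x y y′} → T x y → T x y′ → y ≡ y′) →
    count P? xs ≡ count Q? ys
  count-≡ xs-uniq xs-complete ys-uniq ys-complete f g inj det = ℕ.≤-antisym
    (count-≤ P? Q? T xs-uniq ys-complete f inj)
    (count-≤ Q? P? (flip T) ys-uniq xs-complete g (λ _ _ → det))

-- Finite sequences

lookup-ext : {u v : Vec A n} → (∀ i → lookup u i ≡ lookup v i) → u ≡ v
lookup-ext {u = u} {v} eq =
  trans (sym (tabulate∘lookup u)) (trans (tabulate-cong eq) (tabulate∘lookup v))

involutive⇒injective : {f : A → A} → Involutive _≡_ f → Injective _≡_ _≡_ f
involutive⇒injective {f = f} inv {x} {y} eq = trans (sym (inv x)) (trans (cong f eq) (inv y))

∈-tabulate⇔ : {P : Pred (Fin n) p} (P? : Decidable P) → ∀ x → x ∈ tabulate (does ∘ P?) ⇔ P x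
∈-tabulate⇔ P? x = mk⇔
  (λ x∈ → does⇒ (P? x) (trans (sym (lookup∘tabulate (does ∘ P?) x)) ([]=⇒lookup x∈)))
  (λ Px → lookup⇒[]= x _ (trans (lookup∘tabulate (does ∘ P?) x) (dec-true (P? x) Px)))
  where
  does⇒ : {A : Set a} (A? : Dec A) → does A? ≡ true → A
  does⇒ (yes a) _ = a

module _ {f : Fin m → Fin n} (mono : ∀ a b → a < b → f a < f b) where

  monotone-≤ : ∀ {a b} → a ≤ b → f a ≤ f b
  monotone-≤ {a} {b} a≤b with <-cmp a b
  ... | tri< a<b _ _  = ℕ.<⇒≤ (mono a b a<b)
  ... | tri≈ _ refl _ = ℕ.≤-refl
  ... | tri> _ _ b<a  = contradiction a≤b (ℕ.<⇒≱ b<a)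

  monotone-reflects-< : ∀ {a b} → f a < f b → a < b
  monotone-reflects-< fa<fb = ℕ.≰⇒> λ b≤a → ℕ.<⇒≱ fa<fb (monotone-≤ b≤a)

  monotone-injective : Injective _≡_ _≡_ f
  monotone-injective {a} {b} eq with <-cmp a b
  ... | tri< a<b _ _  = contradiction (mono a b a<b) (<-irrefl eq)
  ... | tri≈ _ a≡b _  = a≡b
  ... | tri> _ _ b<a  = contradiction (mono b a b<a) (<-irrefl (sym eq))

-- The renumbering that deletes the rows and columns without shaded dots: `at` turns a new
-- coordinate into an old one.
record Enumeration (P : Pred (Fin n) p) : Set p where
  field
    size    : ℕ
    at      : Fin size → Fin n
    at-mono : ∀ a b → a < b → at a < at b
    at-∈    : ∀ a → P (at a)
    at-onto : ∀ {x} → P x → ∃ λ a → at a ≡ x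

enumerate : {P : Pred (Fin n) p} → Decidable P → Enumeration P
enumerate {zero}  P? = record
  { size = 0 ; at = λ () ; at-mono = λ () ; at-∈ = λ () ; at-onto = λ { {()} } }
enumerate {suc n} {P = P} P? with P? zero
... | yes P0 = record
  { size    = suc size
  ; at      = λ { zero → zero ; (suc a) → suc (at a) }
  ; at-mono = λ { zero (suc b) _ → s≤s z≤n ; (suc a) (suc b) (s≤s a<b) → s≤s (at-mono a b a<b) }
  ; at-∈    = λ { zero → P0 ; (suc a) → at-∈ a }
  ; at-onto = λ { {zero} _ → zero , refl ; {suc x} Px →
                      let a , eq = at-onto Px in suc a , cong suc eq }
  }
  where open Enumeration (enumerate {P = P ∘ suc} (P? ∘ suc))
... | no ¬P0 = record
  { size    = size
  ; at      = suc ∘ at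
  ; at-mono = λ a b a<b → s≤s (at-mono a b a<b)
  ; at-∈    = at-∈
  ; at-onto = λ { {zero} P0 → contradiction P0 ¬P0 ; {suc x} Px →
                      let a , eq = at-onto Px in a , cong suc eq }
  }
  where open Enumeration (enumerate {P = P ∘ suc} (P? ∘ suc))

-- Serves as a row length: when `P` is down-closed, the positions satisfying `P` are exactly those
-- below this number.
prefixLength : {P : Pred (Fin s) p} → Decidable P → ℕ
prefixLength {zero}  P? = 0
prefixLength {suc s} P? = if does (P? zero) then suc (prefixLength (P? ∘ suc)) else 0

prefixLength-≤ : {P : Pred (Fin s) p} (P? : Decidable P) → prefixLength P? ℕ.≤ s
prefixLength-≤ {zero}  P? = z≤n
prefixLength-≤ {suc s} P? with P? zero
... | yes _ = s≤s (prefixLength-≤ (P? ∘ suc))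
... | no  _ = z≤n

prefixLength-full : {P : Pred (Fin s) p} (P? : Decidable P) → (∀ x → P x) → prefixLength P? ≡ s
prefixLength-full {zero}  P? all = refl
prefixLength-full {suc s} P? all with P? zero
... | yes _  = cong suc (prefixLength-full (P? ∘ suc) (all ∘ suc))
... | no ¬P0 = contradiction (all zero) ¬P0

prefixLength-mono : {P : Pred (Fin s) p} {Q : Pred (Fin s) q} (P? : Decidable P) (Q? : Decidable Q) →
  (∀ {x} → P x → Q x) → prefixLength P? ℕ.≤ prefixLength Q?
prefixLength-mono {zero}  P? Q? P⊆Q = z≤n
prefixLength-mono {suc s} P? Q? P⊆Q with P? zero | Q? zero
... | yes _  | yes _  = s≤s (prefixLength-mono (P? ∘ suc) (Q? ∘ suc) P⊆Q)
... | yes P0 | no ¬Q0 = contradiction (P⊆Q P0) ¬Q0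
... | no _   | _      = z≤n

<prefixLength⇒ : {P : Pred (Fin s) p} (P? : Decidable P) →
  ∀ {x} → toℕ x ℕ.< prefixLength P? → P x
<prefixLength⇒ {suc s} P? {x} x< with P? zero
<prefixLength⇒ {suc s} P? {zero}  x<       | yes P0 = P0
<prefixLength⇒ {suc s} P? {suc x} (s≤s x<) | yes _  = <prefixLength⇒ (P? ∘ suc) x<
<prefixLength⇒ {suc s} P? {x} ()           | no _

<prefixLength⇐ : {P : Pred (Fin s) p} (P? : Decidable P) → (∀ {x y} → x ≤ y → P y → P x) →
  ∀ {x} → P x → toℕ x ℕ.< prefixLength P?
<prefixLength⇐ {suc s} P? down {x} Px with P? zero
<prefixLength⇐ {suc s} P? down {zero}  Px | yes _  = s≤s z≤n
<prefixLength⇐ {suc s} P? down {suc x} Px | yes _  = s≤s (<prefixLength⇐ (P? ∘ suc) (down ∘ s≤s) Px)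
<prefixLength⇐ {suc s} P? down {x}     Px | no ¬P0 = contradiction (down z≤n Px) ¬P0

-- Self-conjugate shapes

open Shape

-- `width` reduces only once the height is known to be zero or positive, and in the latter case it
-- is the length of row zero.
width≡height : (Λ : Shape) → (∀ r → toℕ r ≡ 0 → row Λ r ≡ height Λ) → width Λ ≡ height Λ
width≡height record { height = zero }  _   = refl
width≡height record { height = suc _ } row₀ = row₀ zero refl

-- The Ferrers shape whose boxes are given by `M`: down-closure makes the rows initial segments,
-- symmetry gives self-conjugacy, and `M-cover` excludes empty rows.
module FromRelation {M : Fin s → Fin s → Set} (M? : ∀ x y → Dec (M x y))
  (M-sym : ∀ {x y} → M x y → M y x)
  (M-down : ∀ {x x′ y} → x ≤ x′ → M x′ y → M x y)
  (M-cover : ∀ y → ∃ λ x → M x y) where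

  M-down₂ : ∀ {x y y′} → y ≤ y′ → M x y′ → M x y
  M-down₂ y≤y′ = M-sym ∘ M-down y≤y′ ∘ M-sym

  shape : Shape
  shape = record
    { height   = s
    ; row      = λ y → prefixLength (λ x → M? x y)
    ; antitone = λ y y′ y<y′ → prefixLength-mono (λ x → M? x y′) (λ x → M? x y) (M-down₂ (ℕ.<⇒≤ y<y′))
    ; positive = λ y → let x , Mxy = M-cover y in
                   ℕ.≤-<-trans z≤n (<prefixLength⇐ (λ x → M? x y) M-down Mxy)
    }

  width≡ : width shape ≡ s
  width≡ = width≡height shape λ r r≡0 → prefixLength-full (λ x → M? x r)
    -- By covering and symmetry, column `x` has a box in some row `z`; closing down to row zero
    -- shows that the bottom row meets every column.
    λ x → let z , Mzx = M-cover x in M-down₂ (subst (ℕ._≤ toℕ z) (sym r≡0) z≤n) (M-sym Mzx)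

  ∈ˢ-sym : ∀ x y → (x , y) ∈ˢ shape → (y , x) ∈ˢ shape
  ∈ˢ-sym x y (r , refl , x<) =
    x′ , toℕ-fromℕ< x<s , <prefixLength⇐ (λ z → M? z x′) M-down (M-sym Mx′r)
    where
    x<s  = ℕ.<-≤-trans x< (prefixLength-≤ (λ z → M? z r))
    x′   = fromℕ< x<s
    Mx′r = <prefixLength⇒ (λ z → M? z r)
             (subst (ℕ._< prefixLength (λ z → M? z r)) (sym (toℕ-fromℕ< x<s)) x<)

  selfConjugate : SelfConjugate shape
  selfConjugate x y = mk⇔ (∈ˢ-sym x y) (∈ˢ-sym y x)

  box⇔ : ∀ x y → Box shape x y ⇔ M (cast width≡ x) y
  box⇔ x y = mk⇔
    (λ x< → <prefixLength⇒ (λ z → M? z y) (subst (ℕ._< _) (sym (toℕ-cast width≡ x)) x<))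
    (λ Mxy → subst (ℕ._< _) (toℕ-cast width≡ x) (<prefixLength⇐ (λ z → M? z y) M-down Mxy))

-- `c` is one more than the largest entry, or zero if there are no entries. The last component
-- records that no smaller bound would do.
bound : ∀ {k} (xs : Fin m → Fin k) → ∃ λ (c : Fin (suc k)) →
  (∀ a → toℕ (xs a) ℕ.< toℕ c) × (∀ (x : Fin k) → toℕ x ℕ.< toℕ c → ∃ λ a → x ≤ xs a)
bound {zero}  xs = zero , (λ ()) , λ _ ()
bound {suc m} xs with bound (xs ∘ suc)
... | c , below , attained with toℕ (xs zero) ℕ.<? toℕ c
...   | yes x₀<c = c
                 , (λ { zero → x₀<c ; (suc a) → below a })
                 , λ x x<c → let a , le = attained x x<c in suc a , le
...   | no  x₀≮c = suc (xs zero)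
                 , (λ { zero → ℕ.≤-refl ; (suc a) → ℕ.m<n⇒m<1+n (ℕ.<-≤-trans (below a) (ℕ.≮⇒≥ x₀≮c)) })
                 , λ x x<c → zero , ℕ.s≤s⁻¹ x<c

-- From right to left, the least rectangle around the entries works: each of its boxes lies weakly
-- south-west of some box `(lookup xs a , lookup ys b)`.
inRectangle⇔ : ∀ Λ (xs : Vec (Column Λ) m) (ys : Vec (Row Λ) m) →
  InRectangle Λ xs ys ⇔ (∀ a b → Box Λ (lookup xs a) (lookup ys b))
inRectangle⇔ Λ xs ys = mk⇔
  (λ (c , r , rect , in-cr) a b → rect _ _ (proj₁ (in-cr a)) (proj₂ (in-cr b)))
  λ box →
    let c , xs<c , c-attained = bound (lookup xs)
        r , ys<r , r-attained = bound (lookup ys)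
    in c , r
     , (λ x y x<c y<r →
         let a , x≤ = c-attained x x<c
             b , y≤ = r-attained y y<r
         in ℕ.≤-<-trans x≤ (ℕ.<-≤-trans (box a b) (row-anti y≤)))
     , λ a → xs<c a , ys<r a
  where
  row-anti : ∀ {y y′} → y ≤ y′ → row Λ y′ ℕ.≤ row Λ y
  row-anti {y} {y′} y≤y′ with <-cmp y y′
  ... | tri< y<y′ _ _ = antitone Λ y y′ y<y′
  ... | tri≈ _ refl _ = ℕ.≤-refl
  ... | tri> _ _ y′<y = contradiction y≤y′ (ℕ.<⇒≱ y′<y)

-- Occurrences of α ⊕ τ

Copy : Permutation′ m → Vec (Fin n) n → Pred (Vec (Fin n) m) _
Copy σ w is = Increasing is × HasPattern (λ a → lookup w (lookup is a)) σ

copy-tabulate : (σ : Permutation′ m) (w : Vec (Fin n) n) (f : Fin m → Fin n) →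
  (∀ a b → a < b → f a < f b) → HasPattern (lookup w ∘ f) σ → Copy σ w (tabulate f)
copy-tabulate σ w f mono pat =
    (λ a b a<b → subst₂ _<_ (sym (lookup∘tabulate f a)) (sym (lookup∘tabulate f b)) (mono a b a<b))
  , λ a b → subst₂ (λ x y → lookup w x < lookup w y ⇔ (σ ⟨$⟩ʳ a) < (σ ⟨$⟩ʳ b))
              (sym (lookup∘tabulate f a)) (sym (lookup∘tabulate f b)) (pat a b)

hasPattern-cong : {σ : Permutation′ m} {f g : Fin m → Fin n} →
  (∀ a → f a ≡ g a) → HasPattern f σ → HasPattern g σ
hasPattern-cong eq pat a b rewrite sym (eq a) | sym (eq b) = pat a b

↑ˡ-<-⇔ : ∀ (a b : Fin j) → a < b ⇔ (a ↑ˡ l) < (b ↑ˡ l)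
↑ˡ-<-⇔ {l = l} a b rewrite toℕ-↑ˡ a l | toℕ-↑ˡ b l = mk⇔ (λ x → x) (λ x → x)

↑ʳ-<-⇔ : ∀ (a b : Fin l) → a < b ⇔ (j ↑ʳ a) < (j ↑ʳ b)
↑ʳ-<-⇔ {j = j} a b rewrite toℕ-↑ʳ j a | toℕ-↑ʳ j b = mk⇔ (ℕ.+-monoʳ-< j) (ℕ.+-cancelˡ-< j _ _)

↑ˡ<↑ʳ : ∀ (a : Fin j) (b : Fin l) → (a ↑ˡ l) < (j ↑ʳ b)
↑ˡ<↑ʳ {j} {l} a b rewrite toℕ-↑ˡ a l | toℕ-↑ʳ j b = ℕ.<-≤-trans (toℕ<n a) (ℕ.m≤m+n j (toℕ b))

∀-⊎ : {P : Pred (Fin (j ℕ.+ l)) p} → (∀ a → P (a ↑ˡ l)) → (∀ b → P (j ↑ʳ b)) → ∀ i → P i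
∀-⊎ {j} {l} {P = P} f g i = subst P (join-splitAt j l i) (go (splitAt j i))
  where
  go : ∀ s → P (join j l s)
  go (inj₁ a) = f a
  go (inj₂ b) = g b

module _ (α : Permutation′ j) (τ : Permutation′ l) where

  -- By definition `α ⊕ τ` splits its argument, applies `α` or `τ`, and joins; only the splitting
  -- remains to be evaluated.
  ⊕-↑ˡ : ∀ a → (α ⊕ τ) ⟨$⟩ʳ (a ↑ˡ l) ≡ (α ⟨$⟩ʳ a) ↑ˡ l
  ⊕-↑ˡ a = cong (join j l ∘ Sum.map (α ⟨$⟩ʳ_) (τ ⟨$⟩ʳ_)) (splitAt-↑ˡ j a l)

  ⊕-↑ʳ : ∀ b → (α ⊕ τ) ⟨$⟩ʳ (j ↑ʳ b) ≡ j ↑ʳ (τ ⟨$⟩ʳ b)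
  ⊕-↑ʳ b = cong (join j l ∘ Sum.map (α ⟨$⟩ʳ_) (τ ⟨$⟩ʳ_)) (splitAt-↑ʳ j l b)

  ⊕-↑ˡ-<-⇔ : ∀ a b → (α ⊕ τ) ⟨$⟩ʳ (a ↑ˡ l) < (α ⊕ τ) ⟨$⟩ʳ (b ↑ˡ l) ⇔ (α ⟨$⟩ʳ a) < (α ⟨$⟩ʳ b)
  ⊕-↑ˡ-<-⇔ a b rewrite ⊕-↑ˡ a | ⊕-↑ˡ b = ⇔-sym (↑ˡ-<-⇔ (α ⟨$⟩ʳ a) (α ⟨$⟩ʳ b))

  ⊕-↑ʳ-<-⇔ : ∀ a b → (α ⊕ τ) ⟨$⟩ʳ (j ↑ʳ a) < (α ⊕ τ) ⟨$⟩ʳ (j ↑ʳ b) ⇔ (τ ⟨$⟩ʳ a) < (τ ⟨$⟩ʳ b)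
  ⊕-↑ʳ-<-⇔ a b rewrite ⊕-↑ʳ a | ⊕-↑ʳ b = ⇔-sym (↑ʳ-<-⇔ (τ ⟨$⟩ʳ a) (τ ⟨$⟩ʳ b))

  ⊕-↑ˡ<⊕-↑ʳ : ∀ a b → (α ⊕ τ) ⟨$⟩ʳ (a ↑ˡ l) < (α ⊕ τ) ⟨$⟩ʳ (j ↑ʳ b)
  ⊕-↑ˡ<⊕-↑ʳ a b rewrite ⊕-↑ˡ a | ⊕-↑ʳ b = ↑ˡ<↑ʳ (α ⟨$⟩ʳ a) (τ ⟨$⟩ʳ b)

  module _ (w : Vec (Fin n) n) where

    -- Each pair of indices falls into one of four block cases. Within a block the given copy
    -- decides; across blocks `below` and the layout of `α ⊕ τ` fix both comparisons.
    copy-⊕-join : ∀ is₁ is₂ → Copy α w is₁ → Copy τ w is₂ →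
      (∀ a b → lookup is₁ a < lookup is₂ b × lookup w (lookup is₁ a) < lookup w (lookup is₂ b)) →
      Copy (α ⊕ τ) w (is₁ ++ is₂)
    copy-⊕-join is₁ is₂ (inc₁ , pat₁) (inc₂ , pat₂) below =
        ∀-⊎ (λ a → ∀-⊎ (λ b → inc-ll a b) (λ b → inc-lr a b))
            (λ a → ∀-⊎ (λ b → inc-rl a b) (λ b → inc-rr a b))
      , ∀-⊎ (λ a → ∀-⊎ (λ b → pat-ll a b) (λ b → pat-lr a b))
            (λ a → ∀-⊎ (λ b → pat-rl a b) (λ b → pat-rr a b))
      where
      is = is₁ ++ is₂

      inc-ll : ∀ a b → (a ↑ˡ l) < (b ↑ˡ l) → lookup is (a ↑ˡ l) < lookup is (b ↑ˡ l)
      inc-ll a b lt rewrite lookup-++ˡ is₁ is₂ a | lookup-++ˡ is₁ is₂ b =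
        inc₁ a b (Equivalence.from (↑ˡ-<-⇔ a b) lt)

      inc-lr : ∀ a b → (a ↑ˡ l) < (j ↑ʳ b) → lookup is (a ↑ˡ l) < lookup is (j ↑ʳ b)
      inc-lr a b _ rewrite lookup-++ˡ is₁ is₂ a | lookup-++ʳ is₁ is₂ b = proj₁ (below a b)

      inc-rl : ∀ a b → (j ↑ʳ a) < (b ↑ˡ l) → lookup is (j ↑ʳ a) < lookup is (b ↑ˡ l)
      inc-rl a b lt = contradiction (↑ˡ<↑ʳ b a) (<-asym lt)

      inc-rr : ∀ a b → (j ↑ʳ a) < (j ↑ʳ b) → lookup is (j ↑ʳ a) < lookup is (j ↑ʳ b)
      inc-rr a b lt rewrite lookup-++ʳ is₁ is₂ a | lookup-++ʳ is₁ is₂ b =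
        inc₂ a b (Equivalence.from (↑ʳ-<-⇔ a b) lt)

      PatternAt : (x y : Fin (j ℕ.+ l)) → Set
      PatternAt x y = lookup w (lookup is x) < lookup w (lookup is y)
                        ⇔ (α ⊕ τ) ⟨$⟩ʳ x < (α ⊕ τ) ⟨$⟩ʳ y

      pat-ll : ∀ a b → PatternAt (a ↑ˡ l) (b ↑ˡ l)
      pat-ll a b rewrite lookup-++ˡ is₁ is₂ a | lookup-++ˡ is₁ is₂ b =
        ⇔-sym (⊕-↑ˡ-<-⇔ a b) ⇔-∘ pat₁ a b

      pat-lr : ∀ a b → PatternAt (a ↑ˡ l) (j ↑ʳ b)
      pat-lr a b rewrite lookup-++ˡ is₁ is₂ a | lookup-++ʳ is₁ is₂ b =
        mk⇔ (const (⊕-↑ˡ<⊕-↑ʳ a b)) (const (proj₂ (below a b)))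

      pat-rl : ∀ a b → PatternAt (j ↑ʳ a) (b ↑ˡ l)
      pat-rl a b rewrite lookup-++ʳ is₁ is₂ a | lookup-++ˡ is₁ is₂ b =
        mk⇔ (λ lt → contradiction (proj₂ (below b a)) (<-asym lt))
            (λ lt → contradiction (⊕-↑ˡ<⊕-↑ʳ b a) (<-asym lt))

      pat-rr : ∀ a b → PatternAt (j ↑ʳ a) (j ↑ʳ b)
      pat-rr a b rewrite lookup-++ʳ is₁ is₂ a | lookup-++ʳ is₁ is₂ b =
        ⇔-sym (⊕-↑ʳ-<-⇔ a b) ⇔-∘ pat₂ a b

    copy-⊕-split : ∀ is → Copy (α ⊕ τ) w is →
      ∃ λ is₁ → ∃ λ is₂ → Copy α w is₁ × Copy τ w is₂ ×
      (∀ a b → lookup is₁ a < lookup is₂ b × lookup w (lookup is₁ a) < lookup w (lookup is₂ b))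
    copy-⊕-split is (inc , pat) =
        tabulate left , tabulate right
      , copy-tabulate α w left (λ a b a<b → inc _ _ (Equivalence.to (↑ˡ-<-⇔ a b) a<b))
          (λ a b → ⊕-↑ˡ-<-⇔ a b ⇔-∘ pat (a ↑ˡ l) (b ↑ˡ l))
      , copy-tabulate τ w right (λ a b a<b → inc _ _ (Equivalence.to (↑ʳ-<-⇔ a b) a<b))
          (λ a b → ⊕-↑ʳ-<-⇔ a b ⇔-∘ pat (j ↑ʳ a) (j ↑ʳ b))
      , below
      where
      left : Fin j → _
      left a = lookup is (a ↑ˡ l)

      right : Fin l → _
      right b = lookup is (j ↑ʳ b)

      below : ∀ a b → lookup (tabulate left) a < lookup (tabulate right) b ×
                      lookup w (lookup (tabulate left) a) < lookup w (lookup (tabulate right) b)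
      below a b rewrite lookup∘tabulate left a | lookup∘tabulate right b =
        inc _ _ (↑ˡ<↑ʳ a b) , Equivalence.from (pat (a ↑ˡ l) (j ↑ʳ b)) (⊕-↑ˡ<⊕-↑ʳ a b)

-- The shape cast by the copies of τ

module _ (τ : Permutation′ l) where

  record CopyAbove (w : Vec (Fin n) n) (x y : Fin n) : Set where
    constructor copyAbove
    field
      positions : Vec (Fin n) l
      isCopy    : Copy τ w positions
      above     : ∀ a → x < lookup positions a × y < lookup w (lookup positions a)

  open CopyAbove

  -- On an involution, CopyAbove w y x says that a copy of the inverse of τ
  -- lies strictly to the north-east of (x , y).
  Shaded : Vec (Fin n) n → Fin n → Fin n → Set
  Shaded w x y = CopyAbove w x y ⊎ CopyAbove w y x

  -- Only the decidability matters later, so the search over all words is kept opaque.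
  abstract
    copyAbove? : ∀ (w : Vec (Fin n) n) x y → Dec (CopyAbove w x y)
    copyAbove? w x y =
      map′ (λ (is , copy , above) → copyAbove is copy above) (λ c → positions c , isCopy c , above c)
        (∃word? λ is → (increasing? is ×-dec hasPattern? _ τ)
          ×-dec all? λ a → (x <? lookup is a) ×-dec (y <? lookup w (lookup is a)))

    shaded? : ∀ (w : Vec (Fin n) n) x y → Dec (Shaded w x y)
    shaded? w x y = copyAbove? w x y ⊎-dec copyAbove? w y x

  module _ {w : Vec (Fin n) n} where

    copyAbove-down : ∀ {x x′ y y′} → x ≤ x′ → y ≤ y′ → CopyAbove w x′ y′ → CopyAbove w x y
    copyAbove-down x≤ y≤ c = copyAbove (positions c) (isCopy c) λ a →
      ℕ.≤-<-trans x≤ (proj₁ (above c a)) , ℕ.≤-<-trans y≤ (proj₂ (above c a))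

    shaded-down : ∀ {x x′ y y′} → x ≤ x′ → y ≤ y′ → Shaded w x′ y′ → Shaded w x y
    shaded-down x≤ y≤ = Sum.map (copyAbove-down x≤ y≤) (copyAbove-down y≤ x≤)

    shaded-sym : ∀ {x y} → Shaded w x y → Shaded w y x
    shaded-sym = Sum.swap

  copyAbove-transfer : ∀ {w w′ : Vec (Fin n) n} {x y} (c : CopyAbove w x y) →
    (∀ a → lookup w (lookup (positions c) a) ≡ lookup w′ (lookup (positions c) a)) → CopyAbove w′ x y
  copyAbove-transfer {y = y} (copyAbove is (inc , pat) above) eq =
    copyAbove is (inc , hasPattern-cong {σ = τ} eq pat) λ a →
      proj₁ (above a) , subst (y <_) (eq a) (proj₂ (above a))

  -- A copy of τ with a shaded dot has another copy further out, so every
  -- shaded box is shaded by a copy all of whose dots are unshaded.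
  shaded-outer : ∀ {w w′ : Vec (Fin n) n} →
    (∀ i → ¬ Shaded w i (lookup w i) → lookup w i ≡ lookup w′ i) →
    ∀ {x y} → Shaded w x y → Shaded w′ x y
  shaded-outer {w = w} {w′} agree {x} = go (>-wellFounded x)
    where
    go : ∀ {x y} → Acc _>_ x → Shaded w x y → Shaded w′ x y
    go (acc rs) (inj₁ c@(copyAbove is _ above))
      with any? (λ a → shaded? w (lookup is a) (lookup w (lookup is a)))
    ... | yes (a , sh) = shaded-down (ℕ.<⇒≤ (proj₁ (above a))) (ℕ.<⇒≤ (proj₂ (above a)))
                           (go (rs (proj₁ (above a))) sh)
    ... | no unshaded  = inj₁ (copyAbove-transfer c λ a → agree _ λ sh → unshaded (a , sh))
    -- This copy is north-east of the transposed box, so its shaded dot is transposed too, and the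
    -- row of that dot is the coordinate exceeding `x`.
    go (acc rs) (inj₂ c@(copyAbove is _ above))
      with any? (λ a → shaded? w (lookup is a) (lookup w (lookup is a)))
    ... | yes (a , sh) = shaded-down (ℕ.<⇒≤ (proj₂ (above a))) (ℕ.<⇒≤ (proj₁ (above a)))
                           (go (rs (proj₂ (above a))) (shaded-sym sh))
    ... | no unshaded  = inj₂ (copyAbove-transfer c λ a → agree _ λ sh → unshaded (a , sh))

  ShadedDot : Vec (Fin n) n → Pred (Fin n) _
  ShadedDot w i = Shaded w i (lookup w i)

  shadedDot? : (w : Vec (Fin n) n) → Decidable (ShadedDot w)
  shadedDot? w i = shaded? w i (lookup w i)

  -- Equality of these functions fixes the unshaded dots and also, through `nothing`, the positions
  -- of the shaded ones.
  unshadedDot : Vec (Fin n) n → Fin n → Maybe (Fin n)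
  unshadedDot w i = if does (shadedDot? w i) then nothing else just (lookup w i)

  unshadedDot-nothing : ∀ (w : Vec (Fin n) n) {i} → ShadedDot w i → unshadedDot w i ≡ nothing
  unshadedDot-nothing w {i} sh rewrite dec-true (shadedDot? w i) sh = refl

  unshadedDot-just : ∀ (w : Vec (Fin n) n) {i} → ¬ ShadedDot w i → unshadedDot w i ≡ just (lookup w i)
  unshadedDot-just w {i} ¬sh rewrite dec-false (shadedDot? w i) ¬sh = refl

  record _≈_ (w w′ : Vec (Fin n) n) : Set where
    constructor sameUnshaded
    field
      unshaded≡ : ∀ i → unshadedDot w i ≡ unshadedDot w′ i

  open _≈_

  _≈?_ : Rel.Decidable (_≈_ {n})
  w ≈? w′ = map′ sameUnshaded unshaded≡
    (all? λ i → Maybe.≡-dec _≟_ (unshadedDot w i) (unshadedDot w′ i))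

  ≈-refl : Rel.Reflexive (_≈_ {n})
  ≈-refl = sameUnshaded λ _ → refl

  ≈-sym : Rel.Symmetric (_≈_ {n})
  ≈-sym w≈w′ = sameUnshaded λ i → sym (unshaded≡ w≈w′ i)

  ≈-trans : Rel.Transitive (_≈_ {n})
  ≈-trans w≈w′ w′≈w″ = sameUnshaded λ i → trans (unshaded≡ w≈w′ i) (unshaded≡ w′≈w″ i)

  ≈⇒agree : ∀ {w w′ : Vec (Fin n) n} → w ≈ w′ → ∀ i → ¬ ShadedDot w i → lookup w i ≡ lookup w′ i
  ≈⇒agree {w = w} {w′} w≈w′ i ¬sh with shadedDot? w′ i
  ... | yes sh′ = contradiction
    (trans (sym (unshadedDot-just w ¬sh)) (trans (unshaded≡ w≈w′ i) (unshadedDot-nothing w′ sh′)))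
    λ ()
  ... | no ¬sh′ = Maybe.just-injective
    (trans (sym (unshadedDot-just w ¬sh)) (trans (unshaded≡ w≈w′ i) (unshadedDot-just w′ ¬sh′)))

  -- Used in both directions, this makes the shaded region an invariant of the class.
  ≈⇒shaded : ∀ {w w′ : Vec (Fin n) n} → w ≈ w′ → ∀ {x y} → Shaded w x y → Shaded w′ x y
  ≈⇒shaded w≈w′ = shaded-outer (≈⇒agree w≈w′)

  ≈⇒shadedDot : ∀ {w w′ : Vec (Fin n) n} → w ≈ w′ → ∀ {i} → ShadedDot w i → ShadedDot w′ i
  ≈⇒shadedDot {w = w} {w′} w≈w′ {i} sh with shadedDot? w′ i
  ... | yes sh′ = sh′
  ... | no ¬sh′ = contradiction
    (trans (sym (unshadedDot-nothing w sh)) (trans (unshaded≡ w≈w′ i) (unshadedDot-just w′ ¬sh′))) λ ()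

  module _ {w w′ : Vec (Fin n) n}
    (outside : ∀ i → ¬ ShadedDot w i → lookup w i ≡ lookup w′ i)
    (inside  : ∀ i → ShadedDot w i → Shaded w i (lookup w′ i)) where

    private
      -- Suppose a copy in `w′` shades a box unshaded in `w`. If `w` had a shaded dot in one of the
      -- columns of the copy, `inside` would give a shaded box north-east of the unshaded one (up to
      -- transposition), which is impossible. So `w` and `w′` agree on the copy.
      shaded⁻ : ∀ {x y} → Shaded w′ x y → Shaded w x y
      shaded⁻ {x} {y} sh′ with shaded? w x y
      ... | yes sh = sh
      ... | no ¬sh = Sum.map
        (λ c@(copyAbove _ _ above) → copyAbove-transfer c λ a → sym (outside _ λ sh →
          ¬sh (shaded-down (ℕ.<⇒≤ (proj₁ (above a))) (ℕ.<⇒≤ (proj₂ (above a))) (inside _ sh))))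
        (λ c@(copyAbove _ _ above) → copyAbove-transfer c λ a → sym (outside _ λ sh →
          ¬sh (shaded-down (ℕ.<⇒≤ (proj₂ (above a))) (ℕ.<⇒≤ (proj₁ (above a)))
            (shaded-sym (inside _ sh)))))
        sh′

    -- Moving shaded dots within the shaded region does not change that region: `shaded-outer` keeps
    -- the old shading and `shaded⁻` rules out new shading.
    rearrange-≈ : w ≈ w′
    rearrange-≈ = sameUnshaded λ i → go i (shadedDot? w i)
      where
      go : ∀ i → Dec (ShadedDot w i) → unshadedDot w i ≡ unshadedDot w′ i
      go i (yes sh) = trans (unshadedDot-nothing w sh)
        (sym (unshadedDot-nothing w′ (shaded-outer outside (inside i sh))))
      go i (no ¬sh) = trans (unshadedDot-just w ¬sh) (trans (cong just (outside i ¬sh))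
        (sym (unshadedDot-just w′ (¬sh ∘ subst (Shaded w i) (sym (outside i ¬sh)) ∘ shaded⁻))))

  -- The whole rectangle spanned by the copy is shaded, phrased over all pairs of a column and a row
  -- to match `inRectangle⇔`.
  ShadedCopy : Permutation′ j → Vec (Fin n) n → Set
  ShadedCopy {j} α w = ∃ λ is → Copy α w is × ∀ a b → Shaded w (lookup is a) (lookup w (lookup is b))

  contains-⊕⇒ : (α : Permutation′ j) {w : Vec (Fin n) n} → ContainsPerm (α ⊕ τ) w → ShadedCopy α w
  contains-⊕⇒ α {w} (is , copy) =
    let is₁ , is₂ , copy₁ , copy₂ , below = copy-⊕-split α τ w is copy in
    is₁ , copy₁ , λ a b → inj₁ (copyAbove is₂ copy₂ λ c → proj₁ (below a c) , proj₂ (below b c))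

  -- Reflecting the dots in the diagonal yields the inverse pattern, which is `α` again. The `a`-th
  -- smallest value sits at index `α ⟨$⟩ʳ a`, so this order lists the reflected dots by column.
  copy-transpose : (α : Permutation′ j) → Involutive _≡_ (α ⟨$⟩ʳ_) →
    (w : Vec (Fin n) n) → Involutive _≡_ (lookup w) → ∀ is → Copy α w is →
    Copy α w (tabulate λ a → lookup w (lookup is (α ⟨$⟩ʳ a)))
  copy-transpose α α-inv w w-inv is (inc , pat) = copy-tabulate α w _
    (λ a b a<b → Equivalence.from (pat (α ⟨$⟩ʳ a) (α ⟨$⟩ʳ b))
      (subst₂ _<_ (sym (α-inv a)) (sym (α-inv b)) a<b))
    (λ a b → subst₂ (λ x y → x < y ⇔ (α ⟨$⟩ʳ a) < (α ⟨$⟩ʳ b)) (sym (w-inv _)) (sym (w-inv _))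
               (mk⇔ (monotone-reflects-< inc) (inc _ _)))

  -- It suffices to look at the north-east corner of the rectangle spanned by the copy: whatever is
  -- strictly north-east of the corner is north-east of all its dots.
  contains-⊕⇐ : (α : Permutation′ (suc j)) → Involutive _≡_ (α ⟨$⟩ʳ_) →
    {w : Vec (Fin n) n} → Involutive _≡_ (lookup w) → ShadedCopy α w → ContainsPerm (α ⊕ τ) w
  contains-⊕⇐ {j = j} α α-inv {w} w-inv (is , copy@(inc , pat) , shaded) = combine (shaded last top)
    where
    last top : Fin (suc j)
    last = fromℕ j
    -- The index of the largest value, since `α` sends it back to `last`.
    top  = α ⟨$⟩ʳ last

    ≤last : ∀ a → lookup is a ≤ lookup is last
    ≤last a = monotone-≤ inc (≤fromℕ a)

    ≤top : ∀ a → lookup w (lookup is a) ≤ lookup w (lookup is top)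
    ≤top a = ℕ.≮⇒≥ λ lt →
      ℕ.<⇒≱ (subst (_< (α ⟨$⟩ʳ a)) (α-inv last) (Equivalence.to (pat top a) lt)) (≤fromℕ _)

    combine : Shaded w (lookup is last) (lookup w (lookup is top)) → ContainsPerm (α ⊕ τ) w
    combine (inj₁ (copyAbove is₂ copy₂ above)) =
      is ++ is₂ , copy-⊕-join α τ w is is₂ copy copy₂ λ a b →
        ℕ.≤-<-trans (≤last a) (proj₁ (above b)) , ℕ.≤-<-trans (≤top a) (proj₂ (above b))
    -- Here a copy of `τ` lies north-east of the reflected corner, so the copy of `α` is reflected
    -- to meet it.
    combine (inj₂ (copyAbove is₂ copy₂ above)) =
      tabulate f ++ is₂ ,
      copy-⊕-join α τ w (tabulate f) is₂ (copy-transpose α α-inv w w-inv is copy) copy₂ below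
      where
      f = λ a → lookup w (lookup is (α ⟨$⟩ʳ a))
      below : ∀ a b → lookup (tabulate f) a < lookup is₂ b ×
                      lookup w (lookup (tabulate f) a) < lookup w (lookup is₂ b)
      below a b rewrite lookup∘tabulate f a | w-inv (lookup is (α ⟨$⟩ʳ a)) =
        ℕ.≤-<-trans (≤top _) (proj₁ (above b)) , ℕ.≤-<-trans (≤last _) (proj₂ (above b))

-- Involutions with given unshaded dots

module Class (τ : Permutation′ l) (w₀ : Vec (Fin n) n) (w₀-inv : Involutive _≡_ (lookup w₀)) where

  open Enumeration (enumerate (shadedDot? τ w₀))

  -- The columns with a shaded dot are therefore also the rows with one, so a single enumeration
  -- numbers both.
  shadedDot-image : ∀ {i} → ShadedDot τ w₀ i → ShadedDot τ w₀ (lookup w₀ i)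
  shadedDot-image {i} sh = subst (Shaded τ w₀ (lookup w₀ i)) (sym (w₀-inv i)) (shaded-sym τ sh)

  ShadedBox : Fin size → Fin size → Set
  ShadedBox x y = Shaded τ w₀ (at x) (at y)

  shadedBox? : ∀ x y → Dec (ShadedBox x y)
  shadedBox? x y = shaded? τ w₀ (at x) (at y)

  shadedBox-down : ∀ {x x′ y} → x ≤ x′ → ShadedBox x′ y → ShadedBox x y
  shadedBox-down x≤x′ = shaded-down τ (monotone-≤ at-mono x≤x′) ℕ.≤-refl

  -- The dot in row `at y` is the reflection of the shaded dot in column `at y`.
  shadedBox-cover : ∀ y → ∃ λ x → ShadedBox x y
  shadedBox-cover y =
    let x , eq = at-onto (shadedDot-image (at-∈ y)) in
    x , subst (λ z → Shaded τ w₀ z (at y)) (sym eq) (shaded-sym τ (at-∈ y))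

  open FromRelation shadedBox? (shaded-sym τ) shadedBox-down shadedBox-cover public

  col : Column shape → Fin n
  col x = at (cast width≡ x)

  col-mono : ∀ a b → a < b → col a < col b
  col-mono a b a<b = at-mono _ _
    (subst₂ ℕ._<_ (sym (toℕ-cast width≡ a)) (sym (toℕ-cast width≡ b)) a<b)

  col≡at : ∀ {x y} → toℕ x ≡ toℕ y → col x ≡ at y
  col≡at {x} x≡y = cong at (toℕ-injective (trans (toℕ-cast width≡ x) x≡y))

  abstract
    col-onto : ∀ {i} → ShadedDot τ w₀ i → ∃ λ x → col x ≡ i
    col-onto sh = let a , eq = at-onto sh in
      cast (sym width≡) a , trans (col≡at (toℕ-cast (sym width≡) a)) eq

  col-injective : Injective _≡_ _≡_ col
  col-injective = monotone-injective col-mono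

  at-injective : Injective _≡_ _≡_ at
  at-injective = monotone-injective at-mono

  -- The relation through which `count-≡` compares words with placements; the constructions in both
  -- directions depend on proofs.
  record Represents (w : Vec (Fin n) n) (D : Dots shape) : Set where
    constructor represents
    field
      dot⇔ : ∀ x y → Dot shape D x y ⇔ lookup w (col x) ≡ at y

    dot⇒ : ∀ {x y} → Dot shape D x y → lookup w (col x) ≡ at y
    dot⇒ = Equivalence.to (dot⇔ _ _)

    dot⇐ : ∀ {x y} → lookup w (col x) ≡ at y → Dot shape D x y
    dot⇐ = Equivalence.from (dot⇔ _ _)

  open Represents

  represents-deterministic : ∀ {w D D′} → Represents w D → Represents w D′ → D ≡ D′
  represents-deterministic rep rep′ = lookup-ext λ y → ⊆-antisym
    (λ d → dot⇐ rep′ (dot⇒ rep d))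
    (λ d → dot⇐ rep (dot⇒ rep′ d))

  -- From involutions to placements

  module _ {w : Vec (Fin n) n} (w-inv : Involutive _≡_ (lookup w)) (w₀≈w : _≈_ τ w₀ w) where

    shaded⇒shaded₀ : ∀ {x y} → Shaded τ w x y → Shaded τ w₀ x y
    shaded⇒shaded₀ = ≈⇒shaded τ (≈-sym τ w₀≈w)

    shadedDot₀-inside : ∀ {i} → ShadedDot τ w₀ i → Shaded τ w₀ i (lookup w i)
    shadedDot₀-inside = shaded⇒shaded₀ ∘ ≈⇒shadedDot τ w₀≈w

    -- `w` and `w₀` have the same shaded positions, and those of the involution `w` are closed under
    -- `w`. Thus `w` permutes the kept positions, which makes the placement full.
    shadedDot₀-image : ∀ {i} → ShadedDot τ w₀ i → ShadedDot τ w₀ (lookup w i)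
    shadedDot₀-image {i} sh = ≈⇒shadedDot τ (≈-sym τ w₀≈w)
      (subst (Shaded τ w (lookup w i)) (sym (w-inv i)) (shaded-sym τ (≈⇒shadedDot τ w₀≈w sh)))

    placementRow : Row shape → Subset (width shape)
    placementRow y = tabulate λ x → does (lookup w (col x) ≟ at y)

    placement : Dots shape
    placement = tabulate placementRow

    placement-represents : Represents w placement
    placement-represents = represents λ x y →
      subst (λ R → x ∈ R ⇔ lookup w (col x) ≡ at y) (sym (lookup∘tabulate placementRow y))
        (∈-tabulate⇔ (λ x → lookup w (col x) ≟ at y) x)

    module _ {D : Dots shape} (rep : Represents w D) where

      private
        w-swap : ∀ {i k} → lookup w i ≡ k → lookup w k ≡ i
        w-swap {i} eq = trans (cong (lookup w) (sym eq)) (w-inv i)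

        row-of : ∀ x → ∃ λ y → at y ≡ lookup w (col x)
        row-of x = at-onto (shadedDot₀-image (at-∈ _))

        col-of : ∀ y → ∃ λ x → col x ≡ lookup w (at y)
        col-of y = col-onto (shadedDot₀-image (at-∈ y))

      represents-placement : IsPlacement shape D
      represents-placement = isPlacement
        (λ x y d → Equivalence.from (box⇔ x y)
          (subst (Shaded τ w₀ (col x)) (dot⇒ rep d) (shadedDot₀-inside (at-∈ _))))
        (λ y x x′ d d′ → col-injective (trans (sym (w-swap (dot⇒ rep d))) (w-swap (dot⇒ rep d′))))
        (λ x y y′ d d′ → at-injective (trans (sym (dot⇒ rep d)) (dot⇒ rep d′)))

      represents-full : IsFull shape D
      represents-full =
          (λ y → let x , eq = col-of y in
             x , dot⇐ rep (w-swap (sym eq)) , rowAtMost1 y _ _ (dot⇐ rep (w-swap (sym eq))))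
        , (λ x → let y , eq = row-of x in
             y , dot⇐ rep (sym eq) , colAtMost1 x _ _ (dot⇐ rep (sym eq)))
        where open IsPlacement represents-placement

      represents-symmetric : IsSymmetric shape D
      represents-symmetric x y x′ y′ x′≡y y′≡x = mk⇔
        (λ d → dot⇐ rep (trans (cong (lookup w) (col≡at x′≡y))
          (trans (w-swap (dot⇒ rep d)) (col≡at (sym y′≡x)))))
        (λ d → dot⇐ rep (trans (cong (lookup w) (col≡at (sym y′≡x)))
          (trans (w-swap (dot⇒ rep d)) (col≡at x′≡y))))

      contains⇒shadedCopy : (α : Permutation′ j) → Contains shape α D → ShadedCopy τ α w
      contains⇒shadedCopy α (xs , ys , dots , inc , pat , rect) =
          tabulate is
        , copy-tabulate α w is (λ a b a<b → col-mono _ _ (inc a b a<b))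
            (λ a b → pat a b ⇔-∘ subst₂ (λ y y′ → y < y′ ⇔ lookup ys a < lookup ys b)
              (sym (dot⇒ rep (dots a))) (sym (dot⇒ rep (dots b)))
              (mk⇔ (monotone-reflects-< at-mono) (at-mono _ _)))
        , λ a b → subst₂ (λ i k → Shaded τ w i (lookup w k))
            (sym (lookup∘tabulate is a)) (sym (lookup∘tabulate is b))
            (≈⇒shaded τ w₀≈w (subst (Shaded τ w₀ (is a)) (sym (dot⇒ rep (dots b)))
              (Equivalence.to (box⇔ _ _) (Equivalence.to (inRectangle⇔ shape xs ys) rect a b))))
        where
        is = λ a → col (lookup xs a)

      shadedCopy⇒contains : (α : Permutation′ j) → ShadedCopy τ α w → Contains shape α D
      shadedCopy⇒contains {j} α (is , (inc , pat) , shaded) =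
          xs , ys
        , (λ a → dot⇐ rep (trans (cong (lookup w) (col-xs a)) (sym (at-ys a))))
        , (λ a b a<b → monotone-reflects-< col-mono
            (subst₂ _<_ (sym (col-xs a)) (sym (col-xs b)) (inc a b a<b)))
        , (λ a b → pat a b ⇔-∘ subst₂ (λ i k → lookup ys a < lookup ys b ⇔ i < k) (at-ys a) (at-ys b)
            (mk⇔ (at-mono _ _) (monotone-reflects-< at-mono)))
        , Equivalence.from (inRectangle⇔ shape xs ys) λ a b → Equivalence.from (box⇔ _ _)
            (subst₂ (Shaded τ w₀) (sym (col-xs a)) (sym (at-ys b)) (shaded⇒shaded₀ (shaded a b)))
        where
        preimage : ∀ a → ∃ λ x → col x ≡ lookup is a
        -- The diagonal case of the rectangle condition says that each dot of the copy is itself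
        -- shaded, so its column was kept.
        preimage a = col-onto (≈⇒shadedDot τ (≈-sym τ w₀≈w) (shaded a a))

        xs : Vec (Column shape) j
        xs = tabulate (proj₁ ∘ preimage)

        ys : Vec (Row shape) j
        ys = tabulate (proj₁ ∘ row-of ∘ lookup xs)

        col-xs : ∀ a → col (lookup xs a) ≡ lookup is a
        col-xs a = trans (cong col (lookup∘tabulate (proj₁ ∘ preimage) a)) (proj₂ (preimage a))

        at-ys : ∀ a → at (lookup ys a) ≡ lookup w (lookup is a)
        at-ys a = trans (cong at (lookup∘tabulate (proj₁ ∘ row-of ∘ lookup xs) a))
          (trans (proj₂ (row-of (lookup xs a))) (cong (lookup w) (col-xs a)))

  -- Unshaded dots are those of `w₀`, and shaded ones are read off from `D`.
  represents-injective : ∀ {w w′ D} → Involutive _≡_ (lookup w) → _≈_ τ w₀ w → _≈_ τ w₀ w′ →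
    Represents w D → Represents w′ D → w ≡ w′
  represents-injective {w} {w′} w-inv w₀≈w w₀≈w′ rep rep′ = lookup-ext same
    where
    same : ∀ i → lookup w i ≡ lookup w′ i
    same i with shadedDot? τ w₀ i
    ... | no ¬sh = trans (sym (≈⇒agree τ w₀≈w i ¬sh)) (≈⇒agree τ w₀≈w′ i ¬sh)
    ... | yes sh with col-onto sh | at-onto (shadedDot₀-image w-inv w₀≈w sh)
    ...   | x , refl | y , eq =
      trans (sym eq) (sym (dot⇒ rep′ (dot⇐ rep (sym eq))))

  -- From placements to involutions

  module _ {D : Dots shape}
    (pl : IsPlacement shape D) (full : IsFull shape D) (symm : IsSymmetric shape D) where

    open IsPlacement pl

    private
      dotRow : ∀ {i} → Dec (ShadedDot τ w₀ i) → Fin n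
      dotRow {i} (yes sh) = at (proj₁ (proj₂ full (proj₁ (col-onto sh))))
      dotRow {i} (no ¬sh) = lookup w₀ i

    word : Vec (Fin n) n
    word = tabulate λ i → dotRow (shadedDot? τ w₀ i)

    word-outside : ∀ i → ¬ ShadedDot τ w₀ i → lookup w₀ i ≡ lookup word i
    word-outside i ¬sh = sym (trans (lookup∘tabulate _ i) (go (shadedDot? τ w₀ i)))
      where
      go : ∀ d → dotRow d ≡ lookup w₀ i
      go (yes sh) = contradiction sh ¬sh
      go (no _)   = refl

    dot⇒word : ∀ {x y} → Dot shape D x y → lookup word (col x) ≡ at y
    dot⇒word {x} {y} d = trans (lookup∘tabulate _ (col x)) (go (shadedDot? τ w₀ (col x)))
      where
      go : ∀ d → dotRow d ≡ at y
      go (no ¬sh) = contradiction (at-∈ _) ¬sh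
      -- The column found by `col-onto` is `x` by injectivity, and the dot of `D` in that column is
      -- unique.
      go (yes sh) = cong at (trans
        (cong (λ x → proj₁ (proj₂ full x)) (col-injective (proj₂ (col-onto sh))))
        (proj₂ (proj₂ (proj₂ full x)) d))

    word-represents : Represents word D
    word-represents = represents λ x y → mk⇔ dot⇒word λ eq →
      let y′ , d , _ = proj₂ full x in
      subst (Dot shape D x) (at-injective (trans (sym (dot⇒word d)) eq)) d

    word-inside : ∀ i → ShadedDot τ w₀ i → Shaded τ w₀ i (lookup word i)
    word-inside i sh with col-onto sh
    ... | x , refl = let y , d , _ = proj₂ full x in
      subst (Shaded τ w₀ (col x)) (sym (dot⇒word d)) (Equivalence.to (box⇔ x y) (inShape x y d))

    -- The dots of `D` lie in boxes of the shape, that is, in shaded boxes of `w₀`, as `rearrange-≈`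
    -- demands.
    word-≈ : _≈_ τ w₀ word
    word-≈ = rearrange-≈ τ word-outside word-inside

    word-involutive : Involutive _≡_ (lookup word)
    word-involutive i with shadedDot? τ w₀ i
    -- The image of `i` under `w₀` is also unshaded, so `word` acts as `w₀` twice.
    ... | no ¬sh = trans (cong (lookup word) (sym (word-outside i ¬sh)))
      (trans (sym (word-outside (lookup w₀ i) λ sh →
               ¬sh (subst (ShadedDot τ w₀) (w₀-inv i) (shadedDot-image sh))))
             (w₀-inv i))
    ... | yes sh with col-onto sh
    ...   | x , refl =
      -- The box `(x′ , y′)` is the transpose of `(x , y)`, and it holds a dot by the symmetry of
      -- `D`.
      let y , d , _ = proj₂ full x
          x′ = cast (sym width≡) y
          y′ = cast width≡ x
          x′≡y = toℕ-cast (sym width≡) y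
          y′≡x = toℕ-cast width≡ x
      in trans (cong (lookup word) (trans (dot⇒word d) (sym (col≡at x′≡y))))
               (dot⇒word (Equivalence.to (symm x y x′ y′ x′≡y y′≡x) d))

  -- Containing `α ⊕ τ` on the side of words and containing `α` on the side of placements both
  -- amount to `ShadedCopy`.
  count-class : (α : Permutation′ (suc j)) → Involutive _≡_ (α ⟨$⟩ʳ_) →
    count (involutionAvoiding? (α ⊕ τ) ∩? _≈?_ τ w₀) (words n n) ≡ shape sym⟨ α ⟩
  count-class α α-inv = count-≡
    (involutionAvoiding? (α ⊕ τ) ∩? _≈?_ τ w₀) (symFullAvoiding? shape α) Represents
    (vecs-unique (Unique.allFin⁺ n) n) (vecs-complete ∈-allFin)
    (allDots-unique shape) (allDots-complete shape)
    (λ ((_ , w-inv , avoids) , w₀≈w) →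
      let rep = placement-represents w-inv w₀≈w in
      placement w-inv w₀≈w
      , (represents-placement w-inv w₀≈w rep , represents-full w-inv w₀≈w rep
        , represents-symmetric w-inv w₀≈w rep
        , avoids ∘ contains-⊕⇐ τ α α-inv w-inv ∘ contains⇒shadedCopy w-inv w₀≈w rep α)
      , rep)
    (λ (pl , full , symm , avoids) →
      let w-inv = word-involutive pl full symm
          rep   = word-represents pl full symm
          w₀≈w  = word-≈ pl full symm in
      word pl full symm
      , ((involutive⇒injective {f = lookup (word pl full symm)} w-inv , w-inv
         , avoids ∘ shadedCopy⇒contains w-inv w₀≈w rep α ∘ contains-⊕⇒ τ α) , w₀≈w)
      , rep)
    (λ ((_ , w-inv , _) , w₀≈w) (_ , w₀≈w′) → represents-injective w-inv w₀≈w w₀≈w′)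
    represents-deterministic

-- Exchanging the prefixes

corollary3p7 : (j : ℕ) (α β : Permutation′ j) → Involutive _≡_ (α ⟨$⟩ʳ_) → Involutive _≡_ (β ⟨$⟩ʳ_) →
    ((Λ : Shape) → SelfConjugate Λ → Λ sym⟨ α ⟩ ≡ Λ sym⟨ β ⟩) →
    PrefixesMayBeExchanged α β
-- Here both patterns are τ. The shapes do not help, since every placement
-- contains the empty pattern.
corollary3p7 zero    α β _ _ _ l τ n = refl
corollary3p7 (suc j) α β α-inv β-inv eq l τ n = count-classes
  (_≈?_ τ) (≈-sym τ) (≈-trans τ)
  (involutionAvoiding? (α ⊕ τ)) (involutionAvoiding? (β ⊕ τ))
  -- All involutions serve as representatives, so each one covers itself.
  (words n n) (filter involution? (words n n))
  (λ h → List.lose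
    (∈-filter⁺ involution? (vecs-complete ∈-allFin _) ([ proj₁ ∘ proj₂ , proj₁ ∘ proj₂ ]′ h))
    (≈-refl τ))
  (λ {w₀} w₀∈ →
    let w₀-inv = proj₂ (∈-filter⁻ involution? {xs = words n n} w₀∈)
        open Class τ w₀ w₀-inv
    -- The shape is built from `τ` and `w₀` alone, so the same shape serves `α` and `β`.
    in trans (count-class α α-inv) (trans (eq shape selfConjugate) (sym (count-class β β-inv))))
  where
  involution? : Decidable {A = Vec (Fin n) n} (λ w → Involutive _≡_ (lookup w))
  involution? w = all? λ i → lookup w (lookup w i) ≟ i
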